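{- $\mathrm{ex}^{(3)}_3(12;P)=32$ and $\mathrm{Ex}^{(3)}_3(12;P)=\{\mathrm{Co}(12)\}$. Equivalently: every 12-vertex $P$-free 3-graph that is contained neither in a full star $S^3_{12}$ nor in a copy of $K^3_6\cup K^3_6$ has at most 32 edges, with equality only for the comet $\mathrm{Co}(12)$.
   Context: All hypergraphs are 3-uniform (3-graphs); containment means containing an isomorphic copy as a sub-3-graph. $P$ is the loose 3-uniform path of length 3: vertices $a,b,c,d,e,f,g$, edges $\{a,b,c\},\{c,d,e\},\{e,f,g\}$. $K^3_m$ is the complete 3-graph on $m$ vertices, $\cup$ denotes vertex-disjoint union. $S^3_n$ is the full star on $n$ vertices (all $\binom{n-1}{2}$ triples containing a fixed center). The comet $\mathrm{Co}(n)$ is the $n$-vertex 3-graph with vertex set $\{c,h_1,h_2,h_3\}\cup R$, $|R|=n-4$, whose edges are the four triples of $\{c,h_1,h_2,h_3\}$ together with all triples $\{c,u,v\}$, $u,v\in R$; it has $4+\binom{n-4}{2}$ edges. Turán numbers of order $s$: $\mathrm{ex}^{(1)}_3(n;P)$ is the maximum number of edges of an $n$-vertex $P$-free 3-graph and $\mathrm{Ex}^{(1)}_3(n;P)$ the family of extremal ones; $\mathrm{ex}^{(s+1)}_3(n;P)$ is the maximum number of edges of an $n$-vertex $P$-free 3-graph not contained in any member of $\mathrm{Ex}^{(1)}_3(n;P)\cup\dots\cup\mathrm{Ex}^{(s)}_3(n;P)$, and $\mathrm{Ex}^{(s+1)}_3(n;P)$ is the family of those attaining it. For $n=12$: $\mathrm{Ex}^{(1)}_3(12;P)=\{S^3_{12}\}$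 and $\mathrm{Ex}^{(2)}_3(12;P)=\{K^3_6\cup K^3_6\}$. -}

module Defs where

open import Data.Fin using (Fin; zero; suc; _≟_; #_)
open import Data.Fin.Permutation using (Permutation; _⟨$⟩ʳ_)
open import Data.Fin.Properties using (any?)
open import Data.Fin.Subset
  using (Subset; inside; outside; ⊤; ⊥; ⁅_⁆; _∪_; _∈_; ∣_∣)
open import Data.Fin.Subset.Properties using (_∈?_; _⊆?_; ∣⊥∣≡0)
open import Data.List using (List; []; _∷_; _++_; map; filter; length)
open import Data.List.Membership.Propositional using () renaming (_∈_ to _∈ₗ_)
open import Data.List.Membership.Propositional.Properties using (∈-map⁻)
open import Data.List.Relation.Binary.Disjoint.Propositional using (Disjoint)
open import Data.List.Relation.Unary.All as All using (All; []; _∷_)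
import Data.List.Relation.Unary.All.Properties as Allₚ
open import Data.List.Relation.Unary.AllPairs using ([]; _∷_)
open import Data.List.Relation.Unary.Unique.Propositional using (Unique)
import Data.List.Relation.Unary.Unique.Propositional.Properties as Uniqueₚ
open import Data.Nat using (ℕ; zero; suc; _+_; _≤_; NonZero; pred)
open import Data.Nat.Properties using (+-identityʳ)
open import Data.Product using (Σ; _×_; _,_)
open import Data.Vec as Vec using ([]; _∷_)
import Data.Vec.Properties as Vecₚ
open import Function using (_↣_; _⇔_)
open import Function.Bundles using (module Injection)
open import Relation.Binary.PropositionalEquality
  using (_≡_; refl; sym; trans; cong)
open import Relation.Nullary using (¬_; does)
open import Relation.Nullary.Decidable using (_×-dec_; _⊎-dec_)
open import Relation.Unary using (Pred; Decidable)
open import Level using (0ℓ)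

-- A 3-graph with vertex set Fin n.  The list `edges` stands for a finite set:
-- its order is immaterial, and `unique` makes its length the number of edges.
record ThreeGraph (n : ℕ) : Set where
  field
    edges   : List (Subset n)
    uniform : All (λ e → ∣ e ∣ ≡ 3) edges
    unique  : Unique edges

  size : ℕ
  size = length edges

open ThreeGraph public

image : ∀ {m n} → (Fin m → Fin n) → Subset m → Subset n
image f p = Vec.tabulate λ j → does (any? λ i → (i ∈? p) ×-dec (f i ≟ j))

-- H contains an isomorphic copy of G as a (not necessarily induced)
-- sub-3-graph.
infix 4 _⊑_ _≅_

_⊑_ : ∀ {m n} → ThreeGraph m → ThreeGraph n → Set
_⊑_ {m} {n} G H =
  Σ (Fin m ↣ Fin n) λ f → ∀ e → e ∈ₗ edges G → image (Injection.to f) e ∈ₗ edges H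

_≅_ : ∀ {m n} → ThreeGraph m → ThreeGraph n → Set
_≅_ {m} {n} G H =
  Σ (Permutation m n) λ π → ∀ e → e ∈ₗ edges G ⇔ image (π ⟨$⟩ʳ_) e ∈ₗ edges H

Free : ∀ {k n} → ThreeGraph k → ThreeGraph n → Set
Free F G = ¬ (F ⊑ G)

Maximal : ∀ {n} → Pred (ThreeGraph n) 0ℓ → Pred (ThreeGraph n) 0ℓ
Maximal C G = C G × (∀ H → C H → size H ≤ size G)

-- Candidate F s is the class of F-free 3-graphs over which the Turán number of
-- order s + 1 is taken: those contained in no extremal 3-graph of order 1, …, s.
Candidate : ∀ {k n} → ThreeGraph k → ℕ → Pred (ThreeGraph n) 0ℓ
Candidate F zero    G = Free F G
Candidate {n = n} F (suc s) G =
  Candidate F s G × (∀ (H : ThreeGraph n) → Maximal (Candidate F s) H → ¬ (G ⊑ H))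

-- The family Ex⁽ˢ⁾(n; F), as a predicate on 3-graphs with vertex set Fin n.
Ex : ∀ {k n} (s : ℕ) .{{_ : NonZero s}} → ThreeGraph k → Pred (ThreeGraph n) 0ℓ
Ex s F = Maximal (Candidate F (pred s))

-- ex⁽ˢ⁾(n; F) = m.  This is a relation because the maximum is undefined when
-- there are no candidates.
ex[_]⟨_,_⟩≡_ : ∀ {k} (s : ℕ) .{{_ : NonZero s}} (n : ℕ) → ThreeGraph k → ℕ → Set
ex[ s ]⟨ n , F ⟩≡ m =
  (Σ (ThreeGraph n) λ G → Candidate F (pred s) G × size G ≡ m) ×
  (∀ (G : ThreeGraph n) → Candidate F (pred s) G → size G ≤ m)

subsetsOfSize : ∀ n → ℕ → List (Subset n)
subsetsOfSize zero    zero    = [] ∷ []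
subsetsOfSize zero    (suc k) = []
subsetsOfSize (suc n) zero    = map (outside ∷_) (subsetsOfSize n zero)
subsetsOfSize (suc n) (suc k) =
  map (inside ∷_) (subsetsOfSize n k) ++ map (outside ∷_) (subsetsOfSize n (suc k))

subsetsOfSize-size : ∀ n k → All (λ e → ∣ e ∣ ≡ k) (subsetsOfSize n k)
subsetsOfSize-size zero    zero    = refl ∷ []
subsetsOfSize-size zero    (suc k) = []
subsetsOfSize-size (suc n) zero    = Allₚ.map⁺ (subsetsOfSize-size n zero)
subsetsOfSize-size (suc n) (suc k) =
  Allₚ.++⁺ (Allₚ.map⁺ (All.map (cong suc) (subsetsOfSize-size n k)))
           (Allₚ.map⁺ (subsetsOfSize-size n (suc k)))

subsetsOfSize-unique : ∀ n k → Unique (subsetsOfSize n k)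
subsetsOfSize-unique zero    zero    = [] ∷ []
subsetsOfSize-unique zero    (suc k) = []
subsetsOfSize-unique (suc n) zero    =
  Uniqueₚ.map⁺ Vecₚ.∷-injectiveʳ (subsetsOfSize-unique n zero)
subsetsOfSize-unique (suc n) (suc k) =
  Uniqueₚ.++⁺ (Uniqueₚ.map⁺ Vecₚ.∷-injectiveʳ (subsetsOfSize-unique n k))
              (Uniqueₚ.map⁺ Vecₚ.∷-injectiveʳ (subsetsOfSize-unique n (suc k)))
              disjoint
  where
  disjoint : Disjoint (map (inside ∷_) (subsetsOfSize n k))
                      (map (outside ∷_) (subsetsOfSize n (suc k)))
  disjoint (p , q) with ∈-map⁻ (inside ∷_) p | ∈-map⁻ (outside ∷_) q
  ... | _ , _ , refl | _ , _ , ()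

triplesWith : ∀ {n} {Q : Pred (Subset n) 0ℓ} → Decidable Q → ThreeGraph n
triplesWith {n} Q? = record
  { edges   = filter Q? (subsetsOfSize n 3)
  ; uniform = Allₚ.filter⁺ Q? (subsetsOfSize-size n 3)
  ; unique  = Uniqueₚ.filter⁺ Q? (subsetsOfSize-unique n 3)
  }

Complete : ∀ n → ThreeGraph n
Complete n = record
  { edges   = subsetsOfSize n 3
  ; uniform = subsetsOfSize-size n 3
  ; unique  = subsetsOfSize-unique n 3
  }

FullStar : ∀ {n} → Fin n → ThreeGraph n
FullStar c = triplesWith (c ∈?_)

-- The comet Co(4 + r), where r = |R|: c is vertex 0, the vertices h₁, h₂, h₃
-- are 1, 2, 3, and R consists of the remaining r vertices.
Comet : ∀ r → ThreeGraph (4 + r)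
Comet r = triplesWith λ e → (e ⊆? head) ⊎-dec (e ⊆? tail ×-dec zero ∈? e)
  where
  head tail : Subset (4 + r)
  head = inside ∷ inside  ∷ inside  ∷ inside  ∷ ⊥
  tail = inside ∷ outside ∷ outside ∷ outside ∷ ⊤

∣++∣ : ∀ {m n} (p : Subset m) (q : Subset n) → ∣ p Vec.++ q ∣ ≡ ∣ p ∣ + ∣ q ∣
∣++∣ []            q = refl
∣++∣ (inside  ∷ p) q = cong suc (∣++∣ p q)
∣++∣ (outside ∷ p) q = ∣++∣ p q

infixr 6 _⊍_

-- Vertex-disjoint union: the vertices of G come first, then those of H.
_⊍_ : ∀ {m n} → ThreeGraph m → ThreeGraph n → ThreeGraph (m + n)
_⊍_ {m} {n} G H = record
  { edges   = map left (edges G) ++ map right (edges H)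
  ; uniform = Allₚ.++⁺ (Allₚ.map⁺ (All.map (λ {e} → trans (∣left∣ e)) (uniform G)))
                       (Allₚ.map⁺ (All.map (λ {e} → trans (∣right∣ e)) (uniform H)))
  ; unique  = Uniqueₚ.++⁺
      (Uniqueₚ.map⁺ (λ {p} {q} → Vecₚ.++-injectiveˡ p q) (unique G))
      (Uniqueₚ.map⁺ (λ {_} {_} → Vecₚ.++-injectiveʳ (⊥ {m}) ⊥) (unique H))
      disjoint
  }
  where
  left : Subset m → Subset (m + n)
  left e = e Vec.++ ⊥

  right : Subset n → Subset (m + n)
  right e = ⊥ {m} Vec.++ e

  ∣left∣ : ∀ e → ∣ left e ∣ ≡ ∣ e ∣
  ∣left∣ e = trans (∣++∣ e ⊥) (trans (cong (∣ e ∣ +_) (∣⊥∣≡0 n)) (+-identityʳ _))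

  ∣right∣ : ∀ e → ∣ right e ∣ ≡ ∣ e ∣
  ∣right∣ e = trans (∣++∣ (⊥ {m}) e) (cong (_+ ∣ e ∣) (∣⊥∣≡0 m))

  disjoint : Disjoint (map left (edges G)) (map right (edges H))
  disjoint (p , q) with ∈-map⁻ left p | ∈-map⁻ right q
  ... | e , e∈G , refl | e′ , _ , eq
    with trans (sym (All.lookup (uniform G) e∈G))
               (trans (cong ∣_∣ (Vecₚ.++-injectiveˡ e ⊥ eq)) (∣⊥∣≡0 m))
  ... | ()

LoosePath₃ : ThreeGraph 7
LoosePath₃ = record
  { edges   = (⁅ # 0 ⁆ ∪ ⁅ # 1 ⁆ ∪ ⁅ # 2 ⁆)
            ∷ (⁅ # 2 ⁆ ∪ ⁅ # 3 ⁆ ∪ ⁅ # 4 ⁆)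
            ∷ (⁅ # 4 ⁆ ∪ ⁅ # 5 ⁆ ∪ ⁅ # 6 ⁆)
            ∷ []
  ; uniform = refl ∷ refl ∷ refl ∷ []
  ; unique  = ((λ ()) ∷ (λ ()) ∷ []) ∷ ((λ ()) ∷ []) ∷ [] ∷ []
  }

{-# OPTIONS --safe #-}

-- Let G be P-free.  Suppose G contains a loose triangle; or no loose triangle, but three edges
-- pairwise meeting in the same single vertex; or neither of these, but two edges meeting in a
-- single vertex.  In each case we may relabel so that these two or three edges are fixed.  They
-- rule out most of the 220 triples, and many pairs of the remaining ones conflict, because
-- together with a known edge they would form a configuration that is absent.  After splitting a
-- few times on whether some triple of an orbit of the symmetries is an edge, either all remaining
-- triples lie in a star, in K₆ ∪ K₆ or in a comet, or they are covered by at most 31 cliques of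
-- the conflict graph, each containing at most one edge.  If no two edges meet in a single vertex,
-- one fixed edge suffices.  The star, K₆ ∪ K₆ and the comet have 55, 40 and 32 edges, and neither
-- of the last two embeds in an earlier one, so they are extremal for the orders 1, 2 and 3.
module Submission where

open import Defs
open import Data.Bool using (Bool; true; false; _∧_; _∨_; T; T?)
open import Data.Bool.Properties as Boolₚ using (T-∨)
open import Data.Empty using (⊥-elim)
open import Data.Fin as Fin using (Fin; zero; suc; #_; toℕ; _↑ˡ_)
open import Data.Fin.Permutation as Perm
  using (Permutation; _⟨$⟩ʳ_; _⟨$⟩ˡ_; _∘ₚ_; permutation)
open import Data.Fin.Properties using (any?; injective⇒≤; ↑ˡ-injective)
open import Data.Fin.Subset
  using (Subset; inside; outside; ⊥; ⁅_⁆; _∩_; _∈_; _⊆_; ∣_∣)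
open import Data.Fin.Subset.Properties
  using (⊆-antisym; x∈⁅x⁆; x∈⁅y⁆⇒x≡y; ∣⁅x⁆∣≡1; ∣⊥∣≡0; ∩-comm; x∈p∩q⁺; x∈p∩q⁻; ∉⊥; _∈?_)
open import Data.List
  using (List; []; _∷_; _++_; map; filter; foldr; length; lookup; reverse)
open import Data.List.Membership.Propositional using (find; lose)
  renaming (_∈_ to _∈ₗ_)
open import Data.List.Membership.Propositional.Properties
  using (∈-filter⁺; ∈-filter⁻; ∈-map⁺; ∈-map⁻; ∈-++⁺ˡ; ∈-++⁺ʳ; ∈-lookup)
import Data.List.Membership.DecPropositional as DecMembership
open import Data.List.Properties using (foldr-++; unfold-reverse; length-map)
open import Data.List.Relation.Unary.All as All using (All; []; _∷_)
import Data.List.Relation.Unary.All.Properties as Allₚ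
open import Data.List.Relation.Unary.AllPairs using (_∷_)
open import Data.List.Relation.Unary.Any as Any using (Any; here; there; index)
open import Data.List.Relation.Unary.Any.Properties using (lookup-index)
open import Data.List.Relation.Unary.Unique.Propositional using (Unique)
import Data.List.Relation.Unary.Unique.Propositional.Properties as Uniqueₚ
open import Data.Nat using (ℕ; zero; suc; _≤_; _≤?_; _≡ᵇ_; _≟_; z≤n)
open import Data.Nat.Properties
  using (≤-trans; n≤1+n; m≤m+n; ≤-reflexive; ≤-antisym; suc-injective; 1+n≰n)
open import Data.Product using (Σ; ∃; _×_; _,_; proj₁; proj₂)
open import Data.Sum using (_⊎_; inj₁; inj₂; [_,_]′)
open import Data.Vec as Vec using ([]; _∷_)
import Data.Vec.Properties as Vecₚ
open import Function using (_∘_; id; _⇔_; _↣_; mk⇔; mk↣; Equivalence; Injection)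
open import Function.Definitions using (Injective)
open import Function.Properties.Inverse using (↔⇒↣)
open import Relation.Binary.Definitions using (DecidableEquality)
open import Relation.Binary.PropositionalEquality
  using (_≡_; refl; sym; trans; cong; subst; subst₂)
open import Relation.Nullary using (¬_; Dec; yes; no; does; ¬?; contradiction)
open import Relation.Nullary.Decidable
  using (dec-true; _×-dec_; _⊎-dec_; _→-dec_)

infix 4 _≟ˢ_

_≟ˢ_ : ∀ {n} → DecidableEquality (Subset n)
_≟ˢ_ = Vecₚ.≡-dec Boolₚ._≟_

module _ {n : ℕ} where
  open DecMembership (_≟ˢ_ {n}) public using () renaming (_∈?_ to _∈ₗ?_)

-- Counting

lookup-injective : ∀ {A : Set} {xs : List A} → Unique xs →
                   Injective _≡_ _≡_ (lookup xs)
lookup-injective (x∉xs ∷ u) {zero}  {zero}  eq = refl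
lookup-injective (x∉xs ∷ u) {zero}  {suc j} eq = contradiction eq (All.lookup x∉xs (∈-lookup j))
lookup-injective (x∉xs ∷ u) {suc i} {zero}  eq = contradiction (sym eq)
                                                                 (All.lookup x∉xs (∈-lookup i))
lookup-injective (x∉xs ∷ u) {suc i} {suc j} eq = cong suc (lookup-injective u eq)

-- Sending each element to the position of its hole is injective, as no hole takes two elements. A
-- relation `R` rather than a function lets equality, images of edges and membership in a clique all
-- serve as "lies in the hole".
pigeonhole : ∀ {A B : Set} (R : A → B → Set) {xs : List A} {ys : List B} → Unique xs →
             (∀ {x} → x ∈ₗ xs → Any (R x) ys) →
             (∀ {x x′ y} → x ∈ₗ xs → x′ ∈ₗ xs → y ∈ₗ ys → R x y → R x′ y → x ≡ x′) →
             length xs ≤ length ys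
pigeonhole R {xs} {ys} u cover atMostOne = injective⇒≤ {f = hole} hole-injective
  where
  hole : Fin (length xs) → Fin (length ys)
  hole i = index (cover (∈-lookup i))

  inHole : ∀ i → R (lookup xs i) (lookup ys (hole i))
  inHole i = lookup-index (cover (∈-lookup i))

  hole-injective : Injective _≡_ _≡_ hole
  hole-injective {i} {j} eq = lookup-injective u
    (atMostOne (∈-lookup i) (∈-lookup j) (∈-lookup (hole i)) (inHole i)
      (subst (λ k → R (lookup xs j) (lookup ys k)) (sym eq) (inHole j)))

module _ {A : Set} (_≟_ : DecidableEquality A) where
  open DecMembership _≟_ using () renaming (_∈?_ to _∈′?_)

  -- If some `y` were missing from `xs`, then `y ∷ xs` would be a duplicate-free list drawn from
  -- `ys` and longer than `ys`.
  unique-⊆-full : ∀ {xs ys : List A} → Unique xs → (∀ {x} → x ∈ₗ xs → x ∈ₗ ys) →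
                  length ys ≤ length xs → ∀ {y} → y ∈ₗ ys → y ∈ₗ xs
  unique-⊆-full {xs} {ys} u xs⊆ys ys≤xs {y} y∈ys with y ∈′? xs
  ... | yes y∈xs = y∈xs
  ... | no  y∉xs = contradiction
    (≤-trans (pigeonhole _≡_ (Allₚ.¬Any⇒All¬ xs y∉xs ∷ u) sub (λ _ _ _ p q → trans p (sym q))) ys≤xs)
    1+n≰n
    where
    sub : ∀ {x} → x ∈ₗ y ∷ xs → x ∈ₗ ys
    sub (here refl)  = y∈ys
    sub (there x∈xs) = xs⊆ys x∈xs

-- Images of subsets

does⇒ : ∀ {A : Set} (A? : Dec A) → does A? ≡ true → A
does⇒ (yes a) _ = a

∧-true : ∀ {x y} → x ∧ y ≡ true → x ≡ true × y ≡ true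
∧-true {true} eq = refl , eq

module _ {m n} (f : Fin m → Fin n) where

  inImage? : ∀ p j → Dec (∃ λ i → i ∈ p × f i ≡ j)
  inImage? p j = any? λ i → (i ∈? p) ×-dec (f i Fin.≟ j)

  lookup-image : ∀ p j → Vec.lookup (image f p) j ≡ does (inImage? p j)
  lookup-image p = Vecₚ.lookup∘tabulate (does ∘ inImage? p)

  ∈-image⁺ : ∀ {p i} → i ∈ p → f i ∈ image f p
  ∈-image⁺ {p} {i} i∈p = Vecₚ.lookup⇒[]= _ _
    (trans (lookup-image p (f i)) (dec-true (inImage? p (f i)) (i , i∈p , refl)))

  ∈-image⁻ : ∀ {p j} → j ∈ image f p → ∃ λ i → i ∈ p × f i ≡ j
  ∈-image⁻ {p} {j} j∈ = does⇒ (inImage? p j) (trans (sym (lookup-image p j)) (Vecₚ.[]=⇒lookup j∈))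

  image-⁅⁆ : ∀ i → image f ⁅ i ⁆ ≡ ⁅ f i ⁆
  image-⁅⁆ i = ⊆-antisym to from
    where
    to : image f ⁅ i ⁆ ⊆ ⁅ f i ⁆
    to j∈ with ∈-image⁻ j∈
    ... | _ , k∈ , refl rewrite x∈⁅y⁆⇒x≡y i k∈ = x∈⁅x⁆ (f i)
    from : ⁅ f i ⁆ ⊆ image f ⁅ i ⁆
    from j∈ rewrite x∈⁅y⁆⇒x≡y (f i) j∈ = ∈-image⁺ (x∈⁅x⁆ i)

  image-⊥ : image f ⊥ ≡ ⊥
  image-⊥ = ⊆-antisym (λ j∈ → contradiction (proj₁ (proj₂ (∈-image⁻ j∈))) ∉⊥)
                      (λ j∈ → contradiction j∈ ∉⊥)

  module _ (f-injective : Injective _≡_ _≡_ f) where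

    ∈-image-injective : ∀ {p i} → f i ∈ image f p → i ∈ p
    ∈-image-injective fi∈ with ∈-image⁻ fi∈
    ... | _ , j∈ , eq rewrite f-injective eq = j∈

    image-injective : Injective _≡_ _≡_ (image f)
    image-injective eq =
      ⊆-antisym (λ i∈ → ∈-image-injective (subst (_ ∈_) eq (∈-image⁺ i∈)))
                (λ i∈ → ∈-image-injective (subst (_ ∈_) (sym eq) (∈-image⁺ i∈)))

    image-∩ : ∀ p q → image f p ∩ image f q ≡ image f (p ∩ q)
    image-∩ p q = ⊆-antisym to from
      where
      to : image f p ∩ image f q ⊆ image f (p ∩ q)
      to j∈ with x∈p∩q⁻ (image f p) (image f q) j∈
      ... | j∈p , j∈q with ∈-image⁻ j∈p
      ... | _ , i∈p , refl = ∈-image⁺ (x∈p∩q⁺ (i∈p , ∈-image-injective j∈q))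
      from : image f (p ∩ q) ⊆ image f p ∩ image f q
      from j∈ with ∈-image⁻ j∈
      ... | _ , i∈ , refl with x∈p∩q⁻ p q i∈
      ... | i∈p , i∈q = x∈p∩q⁺ (∈-image⁺ i∈p , ∈-image⁺ i∈q)

image-∘ : ∀ {l m n} (g : Fin m → Fin n) (f : Fin l → Fin m) p →
          image (g ∘ f) p ≡ image g (image f p)
image-∘ g f p = ⊆-antisym to from
  where
  to : image (g ∘ f) p ⊆ image g (image f p)
  to j∈ with ∈-image⁻ (g ∘ f) j∈
  ... | _ , i∈ , refl = ∈-image⁺ g (∈-image⁺ f i∈)
  from : image g (image f p) ⊆ image (g ∘ f) p
  from j∈ with ∈-image⁻ g j∈
  ... | _ , i∈ , refl with ∈-image⁻ f i∈
  ... | _ , h∈ , refl = ∈-image⁺ (g ∘ f) h∈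

image-identity : ∀ {n} {f : Fin n → Fin n} → (∀ i → f i ≡ i) → ∀ p → image f p ≡ p
image-identity {f = f} f≗id p = ⊆-antisym to from
  where
  to : image f p ⊆ p
  to j∈ with ∈-image⁻ f j∈
  ... | i , i∈ , refl = subst (_∈ p) (sym (f≗id i)) i∈
  from : p ⊆ image f p
  from {j} j∈ = subst (_∈ image f p) (f≗id j) (∈-image⁺ f j∈)

image-inverse : ∀ {m n} {f : Fin m → Fin n} {g : Fin n → Fin m} →
                (∀ i → g (f i) ≡ i) → ∀ p → image g (image f p) ≡ p
image-inverse {f = f} {g} g∘f≗id p = trans (sym (image-∘ g f p)) (image-identity g∘f≗id p)

⊑-trans : ∀ {l m n} {F : ThreeGraph l} {G : ThreeGraph m} {H : ThreeGraph n} →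
          F ⊑ G → G ⊑ H → F ⊑ H
⊑-trans {H = H} (f , F→G) (g , G→H) =
    mk↣ (Injection.injective f ∘ Injection.injective g)
  , λ e e∈ → subst (_∈ₗ edges H) (sym (image-∘ (Injection.to g) (Injection.to f) e))
                   (G→H _ (F→G e e∈))

⊑⇒size≤ : ∀ {m n} {G : ThreeGraph m} {H : ThreeGraph n} → G ⊑ H → size G ≤ size H
⊑⇒size≤ {G = G} (f , G→H) = pigeonhole (λ e e′ → image to e ≡ e′) (unique G) (G→H _)
  λ _ _ _ p q → image-injective to (Injection.injective f) (trans p (sym q))
  where open Injection f using (to)

-- Relabelling the vertices by words in the adjacent transpositions

-- Recursion on the bit vector keeps the certificate checks cheap to evaluate, whereas `image`
-- searches all vertices for every entry. An index without a successor position acts as the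
-- identity.
swap : ∀ {n} → ℕ → Subset n → Subset n
swap _       []          = []
swap zero    (x ∷ [])    = x ∷ []
swap zero    (x ∷ y ∷ p) = y ∷ x ∷ p
swap (suc i) (x ∷ p)     = x ∷ swap i p

Word : Set
Word = List ℕ

-- The last letter acts first. Each `swap` is its own inverse, so the reversed word undoes the word.
act unact : ∀ {n} → Word → Subset n → Subset n
act w p = foldr swap p w
unact w = act (reverse w)

swap-involutive : ∀ {n} i (p : Subset n) → swap i (swap i p) ≡ p
swap-involutive _       []          = refl
swap-involutive zero    (x ∷ [])    = refl
swap-involutive zero    (x ∷ y ∷ p) = refl
swap-involutive (suc i) (x ∷ p)     = cong (x ∷_) (swap-involutive i p)

act-++ : ∀ {n} v w (p : Subset n) → act (v ++ w) p ≡ act v (act w p)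
act-++ v w p = foldr-++ swap p v w

unact-∷ : ∀ {n} i w (p : Subset n) → unact (i ∷ w) p ≡ unact w (swap i p)
unact-∷ i w p = trans (cong (λ v → act v p) (unfold-reverse i w)) (act-++ (reverse w) (i ∷ []) p)

unact-act : ∀ {n} w (p : Subset n) → unact w (act w p) ≡ p
unact-act []      p = refl
unact-act (i ∷ w) p = trans (unact-∷ i w _)
  (trans (cong (unact w) (swap-involutive i (act w p))) (unact-act w p))

act-unact : ∀ {n} w (p : Subset n) → act w (unact w p) ≡ p
act-unact []      p = refl
act-unact (i ∷ w) p = trans (cong (swap i ∘ act w) (unact-∷ i w p))
  (trans (cong (swap i) (act-unact w (swap i p))) (swap-involutive i p))

∣swap∣ : ∀ {n} i (p : Subset n) → ∣ swap i p ∣ ≡ ∣ p ∣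
∣swap∣ _       []                      = refl
∣swap∣ zero    (x ∷ [])                = refl
∣swap∣ zero    (inside  ∷ inside  ∷ p) = refl
∣swap∣ zero    (inside  ∷ outside ∷ p) = refl
∣swap∣ zero    (outside ∷ inside  ∷ p) = refl
∣swap∣ zero    (outside ∷ outside ∷ p) = refl
∣swap∣ (suc i) (inside  ∷ p)           = cong suc (∣swap∣ i p)
∣swap∣ (suc i) (outside ∷ p)           = ∣swap∣ i p

∣act∣ : ∀ {n} w (p : Subset n) → ∣ act w p ∣ ≡ ∣ p ∣
∣act∣ []      p = refl
∣act∣ (i ∷ w) p = trans (∣swap∣ i (act w p)) (∣act∣ w p)

swap-∩ : ∀ {n} i (p q : Subset n) → swap i p ∩ swap i q ≡ swap i (p ∩ q)
swap-∩ _       []          []           = refl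
swap-∩ zero    (x ∷ [])    (x′ ∷ [])     = refl
swap-∩ zero    (x ∷ y ∷ p) (x′ ∷ y′ ∷ q) = refl
swap-∩ (suc i) (x ∷ p)     (x′ ∷ q)     = cong (_ ∷_) (swap-∩ i p q)

act-∩ : ∀ {n} w (p q : Subset n) → act w p ∩ act w q ≡ act w (p ∩ q)
act-∩ []      p q = refl
act-∩ (i ∷ w) p q = trans (swap-∩ i (act w p) (act w q)) (cong (swap i) (act-∩ w p q))

∣act-∩∣ : ∀ {n} w (p q : Subset n) → ∣ act w p ∩ act w q ∣ ≡ ∣ p ∩ q ∣
∣act-∩∣ w p q = trans (cong ∣_∣ (act-∩ w p q)) (∣act∣ w (p ∩ q))

adjacent : ∀ {n} → ℕ → Fin n → Fin n
adjacent {suc zero}    zero    j             = j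
adjacent {suc (suc n)} zero    zero          = suc zero
adjacent {suc (suc n)} zero    (suc zero)    = zero
adjacent {suc (suc n)} zero    (suc (suc j)) = suc (suc j)
adjacent               (suc i) zero          = zero
adjacent               (suc i) (suc j)       = suc (adjacent i j)

adjacent-involutive : ∀ {n} i (j : Fin n) → adjacent i (adjacent i j) ≡ j
adjacent-involutive {suc zero}    zero    j             = refl
adjacent-involutive {suc (suc n)} zero    zero          = refl
adjacent-involutive {suc (suc n)} zero    (suc zero)    = refl
adjacent-involutive {suc (suc n)} zero    (suc (suc j)) = refl
adjacent-involutive               (suc i) zero          = refl
adjacent-involutive               (suc i) (suc j)       = cong suc (adjacent-involutive i j)

lookup-swap : ∀ {n} i (p : Subset n) j → Vec.lookup (swap i p) j ≡ Vec.lookup p (adjacent i j)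
lookup-swap zero    (x ∷ [])    j             = refl
lookup-swap zero    (x ∷ y ∷ p) zero          = refl
lookup-swap zero    (x ∷ y ∷ p) (suc zero)    = refl
lookup-swap zero    (x ∷ y ∷ p) (suc (suc j)) = refl
lookup-swap (suc i) (x ∷ p)     zero          = refl
lookup-swap (suc i) (x ∷ p)     (suc j)       = lookup-swap i p j

-- `lookup-swap` describes `swap i p` as a preimage under `adjacent i`; for an involution, preimage
-- and image coincide.
image-adjacent : ∀ {n} i (p : Subset n) → image (adjacent i) p ≡ swap i p
image-adjacent i p = ⊆-antisym to from
  where
  to : image (adjacent i) p ⊆ swap i p
  to j∈ with ∈-image⁻ (adjacent i) j∈
  ... | k , k∈ , refl = Vecₚ.lookup⇒[]= _ _
    (trans (lookup-swap i p (adjacent i k))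
      (trans (cong (Vec.lookup p) (adjacent-involutive i k)) (Vecₚ.[]=⇒lookup k∈)))
  from : swap i p ⊆ image (adjacent i) p
  from {j} j∈ = subst (_∈ image (adjacent i) p) (adjacent-involutive i j)
    (∈-image⁺ (adjacent i)
      (Vecₚ.lookup⇒[]= _ _ (trans (sym (lookup-swap i p j)) (Vecₚ.[]=⇒lookup j∈))))

relabelling : ∀ {n} → Word → Permutation n n
relabelling []      = Perm.id
relabelling (i ∷ w) = relabelling w ∘ₚ
  permutation (adjacent i) (adjacent i) (adjacent-involutive i) (adjacent-involutive i)

image-relabelling : ∀ {n} w (p : Subset n) → image (relabelling w ⟨$⟩ʳ_) p ≡ act w p
image-relabelling []      p = image-identity (λ _ → refl) p
image-relabelling (i ∷ w) p =
  trans (image-∘ (adjacent i) (relabelling w ⟨$⟩ʳ_) p)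
    (trans (image-adjacent i _) (cong (swap i) (image-relabelling w p)))

-- Configurations of three edges

-- The arguments are the sizes of e ∩ f, f ∩ h, e ∩ h and e ∩ f ∩ h. For three triples these numbers
-- fix the configuration up to relabelling, and `∋-act` is immediate because relabelling preserves
-- them.
Config : Set
Config = ℕ → ℕ → ℕ → ℕ → Bool

infix 4 _∋⟨_,_,_⟩

_∋⟨_,_,_⟩ : ∀ {n} → Config → (e f h : Subset n) → Set
X ∋⟨ e , f , h ⟩ = T (X ∣ e ∩ f ∣ (∣ f ∩ h ∣) (∣ e ∩ h ∣) (∣ e ∩ f ∩ h ∣))

config? : ∀ X {n} (e f h : Subset n) → Dec (X ∋⟨ e , f , h ⟩)
config? X e f h = T? _

-- `linear` is the loose path with its middle edge in second place; `path` allows any of the three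
-- as middle edge. `cherry` constrains only the first two edges and carries a third along to fit the
-- common type.
linear path triangle sunflower cherry : Config
linear 1 1 0 _ = true
linear _ _ _ _ = false
path a b c d = linear a b c d ∨ linear b c a d ∨ linear c a b d
triangle 1 1 1 0 = true
triangle _ _ _ _ = false
sunflower 1 1 1 1 = true
sunflower _ _ _ _ = false
cherry 1 _ _ _ = true
cherry _ _ _ _ = false

infixr 6 _or_

_or_ : Config → Config → Config
(X or Y) a b c d = X a b c d ∨ Y a b c d

linear⇒ : ∀ a b c d → T (linear a b c d) → a ≡ 1 × b ≡ 1 × c ≡ 0
linear⇒ 1 1 0 _ _ = refl , refl , refl

triangle⇒cherry : ∀ a b c d → T (triangle a b c d) → a ≡ 1
triangle⇒cherry 1 1 1 0 _ = refl

sunflower⇒cherry : ∀ a b c d → T (sunflower a b c d) → a ≡ 1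
sunflower⇒cherry 1 1 1 1 _ = refl

cherry⇒ : ∀ a b c d → T (cherry a b c d) → a ≡ 1
cherry⇒ 1 _ _ _ _ = refl

linear-∩ : ∀ {n} (e f h : Subset n) → ∣ e ∩ f ∣ ≡ 1 × ∣ f ∩ h ∣ ≡ 1 × ∣ e ∩ h ∣ ≡ 0 →
           linear ∋⟨ e , f , h ⟩
linear-∩ e f h (p , q , r) rewrite p | q | r = _

sunflower-∩ : ∀ {n} (e f h : Subset n) → ∣ e ∩ f ∣ ≡ 1 → ∣ f ∩ h ∣ ≡ 1 → ∣ e ∩ h ∣ ≡ 1 →
              ∣ e ∩ f ∩ h ∣ ≡ 1 → sunflower ∋⟨ e , f , h ⟩
sunflower-∩ e f h p q r s rewrite p | q | r | s = _

∣∩∣-comm : ∀ {n} (p q : Subset n) → ∣ p ∩ q ∣ ≡ ∣ q ∩ p ∣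
∣∩∣-comm p q = cong ∣_∣ (∩-comm p q)

Triples : Set
Triples = List (Subset 12)

Avoids Contains : Config → Triples → Set
Avoids X G = ∀ {e f h} → e ∈ₗ G → f ∈ₗ G → h ∈ₗ G → ¬ X ∋⟨ e , f , h ⟩
Contains X G = ∃ λ e → ∃ λ f → ∃ λ h → (e ∈ₗ G × f ∈ₗ G × h ∈ₗ G) × X ∋⟨ e , f , h ⟩

avoids-or : ∀ X Y {G} → Avoids X G → Avoids Y G → Avoids (X or Y) G
avoids-or X Y x y e∈ f∈ h∈ = [ x e∈ f∈ h∈ , y e∈ f∈ h∈ ]′ ∘ Equivalence.to T-∨

contains⊎avoids : ∀ X G → Contains X G ⊎ Avoids X G
contains⊎avoids X G with Any.any? (λ e → Any.any? (λ f → Any.any? (config? X e f) G) G) G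
... | yes some with find some
...   | e , e∈ , some′ with find some′
...   | f , f∈ , some″ with find some″
...   | h , h∈ , x = inj₁ (e , f , h , (e∈ , f∈ , h∈) , x)
contains⊎avoids X G | no none = inj₂ λ e∈ f∈ h∈ x → none (lose e∈ (lose f∈ (lose h∈ x)))

∋-act : ∀ X {n} w (e f h : Subset n) → X ∋⟨ e , f , h ⟩ → X ∋⟨ act w e , act w f , act w h ⟩
∋-act X w e f h x
  rewrite ∣act-∩∣ w e f | ∣act-∩∣ w f h | ∣act-∩∣ w e h | act-∩ w f h | ∣act-∩∣ w e (f ∩ h) = x

triple : ∀ {n} → ℕ → ℕ → ℕ → Subset n
triple a b c = Vec.tabulate λ i → (toℕ i ≡ᵇ a) ∨ (toℕ i ≡ᵇ b) ∨ (toℕ i ≡ᵇ c)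

∈-subsetsOfSize : ∀ {n} k (p : Subset n) → ∣ p ∣ ≡ k → p ∈ₗ subsetsOfSize n k
∈-subsetsOfSize zero    []            eq = here refl
∈-subsetsOfSize zero    (outside ∷ p) eq = ∈-map⁺ (outside ∷_) (∈-subsetsOfSize zero p eq)
∈-subsetsOfSize (suc k) (inside  ∷ p) eq =
  ∈-++⁺ˡ (∈-map⁺ (inside ∷_) (∈-subsetsOfSize k p (suc-injective eq)))
∈-subsetsOfSize {suc n} (suc k) (outside ∷ p) eq =
  ∈-++⁺ʳ (map (inside ∷_) (subsetsOfSize n k))
         (∈-map⁺ (outside ∷_) (∈-subsetsOfSize (suc k) p eq))

-- Opaque, because conversion checking must not enumerate this list.
opaque
  triples : Triples
  triples = subsetsOfSize 12 3

  ∈-triples : ∀ {p} → ∣ p ∣ ≡ 3 → p ∈ₗ triples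
  ∈-triples {p} = ∈-subsetsOfSize 3 p

-- Orbits

inSpread? : ∀ g R c → Dec (c ∈ₗ R ⊎ unact {12} g c ∈ₗ R)
inSpread? g R c = (c ∈ₗ? R) ⊎-dec (unact g c ∈ₗ? R)

spread : Word → Triples → Triples → Triples
spread g C R = filter (inSpread? g R) C

-- Each entry of `gs` is applied once, the last entry first, so the result need not be a full group
-- orbit, and move lists may repeat a word. Soundness rests on every member being reached from `t`
-- by moves.
orbit : Subset 12 → List Word → Triples → Triples
orbit t gs C = foldr (λ g → spread g C) (t ∷ []) gs

orbit-closed : (Q : Subset 12 → Set) → ∀ {t} gs {C} → Q t →
               All (λ g → ∀ {u} → Q u → Q (act g u)) gs → ∀ {u} → u ∈ₗ orbit t gs C → Q u
orbit-closed Q []       q []             (here refl) = q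
orbit-closed Q {t} (g ∷ gs) {C} q (closed ∷ cls) u∈
  with ∈-filter⁻ (inSpread? g (orbit t gs C)) {xs = C} u∈
... | _ , inj₁ old = orbit-closed Q gs {C} q cls old
... | _ , inj₂ new = subst Q (act-unact g _) (closed (orbit-closed Q gs {C} q cls new))

reachable? : (as : Triples) (gs : List Word) (C R : Triples) →
             Dec (All (λ g → All (λ a → act g a ≡ a) as) gs × All (_∈ₗ R) C)
reachable? as gs C R =
  All.all? (λ g → All.all? (λ a → act g a ≟ˢ a) as) gs ×-dec All.all? (_∈ₗ? R) C

module _ (as : Triples) (t : Subset 12) (gs : List Word) (C : Triples) where

  Reached : Subset 12 → Set
  Reached c = ∃ λ w → All (λ a → act w a ≡ a) as × act w t ≡ c

  -- Concatenating the moves along the way from `t` to `c` gives a word that fixes `as`. This is how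
  -- a further edge is normalised while the edges already normalised stay in place.
  reach : does (reachable? as gs C (orbit t gs C)) ≡ true → ∀ {c} → c ∈ₗ C → Reached c
  reach checked c∈ with does⇒ (reachable? as gs C (orbit t gs C)) checked
  ... | fixed , covered = orbit-closed Reached gs {C} ([] , All.universal (λ _ → refl) as , refl)
          (All.map (λ {g} → step {g}) fixed) (All.lookup covered c∈)
    where
    step : ∀ {g} → All (λ a → act g a ≡ a) as → ∀ {u} → Reached u → Reached (act g u)
    step {g} fix (w , fix′ , eq) =
        g ++ w
      , All.zipWith (λ { (p , q) → trans (act-++ g w _) (trans (cong (act g) q) p) }) (fix , fix′)
      , trans (act-++ g w t) (cong (act g) eq)

-- Certificates

star K₆K₆ comet : ThreeGraph 12
star  = FullStar zero
K₆K₆  = Complete 6 ⊍ Complete 6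
comet = Comet 8

opaque
  hosts : List (ThreeGraph 12)
  hosts = star ∷ K₆K₆ ∷ comet ∷ []

-- A certificate refers to a 3-graph, some relabelling of which contains the triples in K and
-- has all its edges in C.  `inside w` relabels C by w into a host; `cover` bounds the number of
-- edges by the number of cliques of conflicting triples needed to cover C; `split t gs l r`
-- treats the case that t is an edge in l and removes its orbit under gs from C in r.
data Cert : Set where
  inside : Word → Cert
  cover  : Cert
  split  : Subset 12 → List Word → Cert → Cert → Cert

-- The known edge comes third, so for `cherry` and nonempty `K` two triples conflict exactly when
-- they meet in one vertex.
Conflict : Config → Triples → Subset 12 → Subset 12 → Set
Conflict X K c d = Any (λ k → X ∋⟨ c , d , k ⟩) K

conflict? : ∀ X K c d → Dec (Conflict X K c d)
conflict? X K c d = Any.any? (config? X c d) K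

-- Greedy: `c` joins the first clique with all of whose members it conflicts, and otherwise opens a
-- new one. Every clique partition gives a valid bound.
place : Config → Triples → Subset 12 → List Triples → List Triples
place X K c []       = (c ∷ []) ∷ []
place X K c (q ∷ qs) with does (All.all? (conflict? X K c) q)
... | true  = (c ∷ q) ∷ qs
... | false = q ∷ place X K c qs

cliques : Config → Triples → Triples → List Triples
cliques X K = foldr (place X K) []

narrow : Config → Triples → Subset 12 → Triples → Triples
narrow X K t = filter (λ c → ¬? (conflict? X K t c))

-- Such a `g` is a symmetry of the current state: it sends known triples to known triples and pulls
-- possible triples back to possible ones, which is what `fits-act` uses.
Stable : (K C : Triples) → Word → Set
Stable K C g = All (λ k → act g k ∈ₗ K) K × All (λ c → unact g c ∈ₗ C) C

stable? : ∀ K C g → Dec (Stable K C g)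
stable? K C g = All.all? (λ k → act g k ∈ₗ? K) K ×-dec All.all? (λ c → unact g c ∈ₗ? C) C

_∖_ : Triples → Triples → Triples
C ∖ R = filter (λ c → ¬? (c ∈ₗ? R)) C

inside? : ∀ w C (S : ThreeGraph 12) → Dec (All (λ c → unact w c ∈ₗ edges S) C)
inside? w C S = All.all? (λ c → unact w c ∈ₗ? edges S) C

check : Config → Cert → (K C : Triples) → Bool
check X (inside w)       K C = does (Any.any? (inside? w C) hosts)
-- 31 is one below the size of the comet, so these leaves never meet the case of equality.
check X cover            K C = does (length (cliques X K C) ≤? 31)
check X (split t gs l r) K C =
  does (All.all? (stable? K C) gs) ∧
  check X l (t ∷ K) (narrow X (t ∷ K) t C) ∧ check X r K (C ∖ orbit t gs C)

candidates : Config → Triples → Triples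
candidates X []      = triples
candidates X (t ∷ K) = narrow X (t ∷ K) t (candidates X K)

-- Soundness of certificates

infix 4 _↪_

-- Keeping a permutation, rather than an injection as in `⊑`, makes it available as the isomorphism
-- when the sizes agree.
_↪_ : Triples → ThreeGraph 12 → Set
G ↪ S = Σ (Permutation 12 12) λ π → ∀ {e} → e ∈ₗ G → image (π ⟨$⟩ʳ_) e ∈ₗ edges S

data Bounded (G : Triples) : Set where
  small    : length G ≤ 31 → Bounded G
  embedded : Any (G ↪_) hosts → Bounded G

-- `K` and `C` are written in normalised coordinates, and `w` carries these to the vertices of `G`.
record Fits (G : Triples) (w : Word) (K C : Triples) : Set where
  constructor fits
  field
    known    : All (λ k → act w k ∈ₗ G) K
    possible : ∀ {c} → act w c ∈ₗ G → c ∈ₗ C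

module _ {X : Config} {G : Triples} (avoids : Avoids X G) where

  AtMostOne : Word → Triples → Set
  AtMostOne w q = ∀ {c d} → c ∈ₗ q → d ∈ₗ q → act w c ∈ₗ G → act w d ∈ₗ G → c ≡ d

  no-conflict : ∀ w {K} c d → All (λ k → act w k ∈ₗ G) K → act w c ∈ₗ G → act w d ∈ₗ G →
                ¬ Conflict X K c d
  no-conflict w c d known c∈ d∈ conflict with find conflict
  ... | k , k∈ , x = avoids c∈ d∈ (All.lookup known k∈) (∋-act X w c d k x)

  module _ w {K} (known : All (λ k → act w k ∈ₗ G) K) where

    place-atMostOne : ∀ c qs → All (AtMostOne w) qs → All (AtMostOne w) (place X K c qs)
    place-atMostOne c []       []       = (λ { (here refl) (here refl) _ _ → refl }) ∷ []
    place-atMostOne c (q ∷ qs) (a ∷ as) with All.all? (conflict? X K c) q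
    ... | no  _     = a ∷ place-atMostOne c qs as
    ... | yes clash = one ∷ as
      where
      one : AtMostOne w (c ∷ q)
      one (here refl) (here refl) _ _ = refl
      one {d = d} (here refl) (there d∈) x y = ⊥-elim (no-conflict w c d known x y (All.lookup clash d∈))
      one {c = b} (there b∈) (here refl) x y = ⊥-elim (no-conflict w c b known y x (All.lookup clash b∈))
      one (there b∈) (there d∈) x y = a b∈ d∈ x y

    cliques-atMostOne : ∀ C → All (AtMostOne w) (cliques X K C)
    cliques-atMostOne []      = []
    cliques-atMostOne (c ∷ C) = place-atMostOne c (cliques X K C) (cliques-atMostOne C)

  place-here : ∀ K c qs → Any (c ∈ₗ_) (place X K c qs)
  place-here K c []       = here (here refl)
  place-here K c (q ∷ qs) with does (All.all? (conflict? X K c) q)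
  ... | true  = here (here refl)
  ... | false = there (place-here K c qs)

  place-there : ∀ K c qs {d} → Any (d ∈ₗ_) qs → Any (d ∈ₗ_) (place X K c qs)
  place-there K c (q ∷ qs) d∈ with does (All.all? (conflict? X K c) q)
  place-there K c (q ∷ qs) (here d∈)  | true  = here (there d∈)
  place-there K c (q ∷ qs) (there d∈) | true  = there d∈
  place-there K c (q ∷ qs) (here d∈)  | false = here d∈
  place-there K c (q ∷ qs) (there d∈) | false = there (place-there K c qs d∈)

  cliques-cover : ∀ K {C c} → c ∈ₗ C → Any (c ∈ₗ_) (cliques X K C)
  cliques-cover K {C = c ∷ C} (here refl) = place-here K c (cliques X K C)
  cliques-cover K {C = d ∷ C} (there c∈)  = place-there K d (cliques X K C) (cliques-cover K c∈)

  act-unact-∈ : ∀ w e → e ∈ₗ G → act w (unact w e) ∈ₗ G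
  act-unact-∈ w e = subst (_∈ₗ G) (sym (act-unact w e))

  -- Pigeonhole with cliques as holes: every edge, pulled back by `w`, lies in some clique, and two
  -- edges in one clique would complete a configuration that `G` avoids.
  length≤cliques : ∀ w {K C} → Unique G → Fits G w K C → length G ≤ length (cliques X K C)
  length≤cliques w {K} {C} u (fits known possible) = pigeonhole (λ e q → unact w e ∈ₗ q) u
    (λ {e} e∈ → cliques-cover K (possible (act-unact-∈ w e e∈)))
    (λ {e} {e′} e∈ e′∈ q∈ x y →
      trans (sym (act-unact w e))
        (trans (cong (act w) (All.lookup (cliques-atMostOne w known C) q∈ x y
                               (act-unact-∈ w e e∈) (act-unact-∈ w e′ e′∈)))
               (act-unact w e′)))

  fits-∷ : ∀ w {K C t} → Fits G w K C → act w t ∈ₗ G → Fits G w (t ∷ K) (narrow X (t ∷ K) t C)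
  fits-∷ w {K} {C} {t} (fits known possible) t∈ = fits (t∈ ∷ known) λ {c} c∈ →
    ∈-filter⁺ (λ c → ¬? (conflict? X (t ∷ K) t c)) (possible c∈)
              (no-conflict w t c (t∈ ∷ known) t∈ c∈)

  fits-candidates : All (λ e → ∣ e ∣ ≡ 3) G → ∀ w K → All (λ k → act w k ∈ₗ G) K →
                    Fits G w K (candidates X K)
  fits-candidates size3 w []      []           = fits [] λ {c} c∈ →
    ∈-triples (trans (sym (∣act∣ w c)) (All.lookup size3 c∈))
  fits-candidates size3 w (t ∷ K) (t∈ ∷ known) =
    fits-∷ w (fits-candidates size3 w K known) t∈

  -- If the edge found corresponds to `act g u`, the coordinates are changed by the symmetry `g` so
  -- that it corresponds to `u` itself.
  fits-act : ∀ w {K C} g u → Stable K C g → Fits G w (act g u ∷ K) C → Fits G (w ++ g) (u ∷ K) C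
  fits-act w {K} {C} g u (stableK , stableC) (fits (gu∈ ∷ known) possible) = fits
    (subst (_∈ₗ G) (sym (act-++ w g u)) gu∈ ∷
      All.map (λ {k} gk∈ → subst (_∈ₗ G) (sym (act-++ w g k)) (All.lookup known gk∈)) stableK)
    (λ {c} c∈ → subst (_∈ₗ C) (unact-act g c)
      (All.lookup stableC (possible (subst (_∈ₗ G) (act-++ w g c) c∈))))

  check-sound : Unique G → ∀ cert w {K C} → check X cert K C ≡ true → Fits G w K C → Bounded G
  check-sound u (inside v) w {C = C} ok (fits _ possible) =
    embedded (Any.map (λ {S} → embed {S}) (does⇒ (Any.any? (inside? v C) hosts) ok))
    where
    embed : ∀ {S} → All (λ c → unact v c ∈ₗ edges S) C → G ↪ S
    -- The word first undoes `w`, reaching the coordinates of `C`, and then undoes `v`, reaching the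
    -- host.
    embed {S} all = relabelling (reverse v ++ reverse w) , λ {e} e∈ →
      subst (_∈ₗ edges S)
        (sym (trans (image-relabelling (reverse v ++ reverse w) e) (act-++ (reverse v) (reverse w) e)))
        (All.lookup all (possible (act-unact-∈ w e e∈)))
  check-sound u cover w {K} {C} ok fit = small
    (≤-trans (length≤cliques w u fit) (does⇒ (length (cliques X K C) ≤? 31) ok))
  check-sound u (split t gs l r) w {K} {C} ok fit
    with ∧-true ok
  ... | stable , ok′ with ∧-true ok′
  ... | okˡ , okʳ with Any.any? (λ c → act w c ∈ₗ? G) (orbit t gs C)
  ... | yes some with find some
  ...   | c , c∈ , wc∈ =
    orbit-closed Q gs {C} base
      (All.map (λ {g} st {u} → step g u st) (does⇒ (All.all? (stable? K C) gs) stable)) c∈ w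
      (fits (wc∈ ∷ Fits.known fit) (Fits.possible fit))
    where
    Q : Subset 12 → Set
    -- The quantifier over `w` is essential for the induction along the orbit: each move back
    -- towards `t` changes the relabelling.
    Q c = ∀ w → Fits G w (c ∷ K) C → Bounded G
    base : Q t
    base w (fits (t∈ ∷ known) possible) =
      check-sound u l w okˡ (fits-∷ w (fits known possible) t∈)
    step : ∀ g u → Stable K C g → Q u → Q (act g u)
    step g u st q w fit = q (w ++ g) (fits-act w g u st fit)
  check-sound u (split t gs l r) w {K} {C} ok fit | _ , _ | _ , okʳ | no none =
    check-sound u r w okʳ (fits (Fits.known fit) λ {c} c∈ →
      ∈-filter⁺ (λ c → ¬? (c ∈ₗ? orbit t gs C)) (Fits.possible fit c∈)
                (λ c∈orbit → none (lose c∈orbit c∈)))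

-- Normal forms of the configurations

e₀ f₀ : Subset 12
e₀ = triple 0 1 2
f₀ = triple 2 3 4

-- The move lists and the certificates below were found by a greedy computer search.
edgeMoves : List Word
edgeMoves =
  (8 ∷ []) ∷ (6 ∷ 7 ∷ []) ∷ (5 ∷ 6 ∷ []) ∷ (3 ∷ 4 ∷ 5 ∷ []) ∷ (7 ∷ 10 ∷ [])
  ∷ (4 ∷ 9 ∷ 10 ∷ []) ∷ (3 ∷ 8 ∷ 9 ∷ 10 ∷ []) ∷ (0 ∷ 6 ∷ 7 ∷ 8 ∷ 9 ∷ [])
  ∷ (2 ∷ 7 ∷ 8 ∷ []) ∷ (4 ∷ 5 ∷ 6 ∷ 7 ∷ 4 ∷ 5 ∷ 6 ∷ 7 ∷ [])
  ∷ (1 ∷ 2 ∷ 3 ∷ 4 ∷ 5 ∷ 6 ∷ []) ∷ (3 ∷ 4 ∷ 5 ∷ []) ∷ (2 ∷ 3 ∷ 4 ∷ []) ∷ (0 ∷ 3 ∷ [])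
  ∷ (1 ∷ 2 ∷ 3 ∷ []) ∷ (2 ∷ []) ∷ []

cherryMoves : List Word
cherryMoves =
  (0 ∷ []) ∷ (0 ∷ 8 ∷ 9 ∷ 10 ∷ []) ∷ (6 ∷ 9 ∷ 10 ∷ []) ∷ (5 ∷ 6 ∷ 7 ∷ 8 ∷ 9 ∷ [])
  ∷ (6 ∷ 7 ∷ 8 ∷ 6 ∷ 7 ∷ 8 ∷ []) ∷ (0 ∷ 5 ∷ 6 ∷ []) ∷ (0 ∷ 4 ∷ 5 ∷ 6 ∷ [])
  ∷ (3 ∷ 4 ∷ 5 ∷ []) ∷ (4 ∷ []) ∷ (1 ∷ []) ∷ []

linearMoves : List Word
linearMoves =
  (8 ∷ 9 ∷ 10 ∷ []) ∷ (8 ∷ 9 ∷ 10 ∷ 8 ∷ 9 ∷ 10 ∷ []) ∷ (7 ∷ 8 ∷ 9 ∷ [])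
  ∷ (6 ∷ 7 ∷ 8 ∷ []) ∷ (5 ∷ 6 ∷ 7 ∷ []) ∷ (6 ∷ []) ∷ (3 ∷ []) ∷ []

triangleMoves : List Word
triangleMoves =
  (10 ∷ []) ∷ (7 ∷ 8 ∷ 9 ∷ 7 ∷ 8 ∷ 9 ∷ []) ∷ (5 ∷ 6 ∷ 7 ∷ 5 ∷ 6 ∷ 7 ∷ []) ∷ (5 ∷ [])
  ∷ (3 ∷ []) ∷ (0 ∷ []) ∷ []

sunflowerMoves : List Word
sunflowerMoves =
  (8 ∷ 9 ∷ 10 ∷ []) ∷ (8 ∷ 9 ∷ 10 ∷ 8 ∷ 9 ∷ 10 ∷ []) ∷ (7 ∷ 8 ∷ 9 ∷ [])
  ∷ (6 ∷ 7 ∷ 8 ∷ []) ∷ (5 ∷ 6 ∷ 7 ∷ []) ∷ (6 ∷ []) ∷ []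

meetsOnce? : ∀ {n} (e f : Subset n) → Dec (∣ e ∩ f ∣ ≡ 1)
meetsOnce? e f = ∣ e ∩ f ∣ ≟ 1

completions : Config → Triples
completions X = filter (config? X e₀ f₀) triples

ReachesCompletions : Config → Subset 12 → List Word → Set
ReachesCompletions X h₀ gs =
  does (reachable? (e₀ ∷ f₀ ∷ []) gs (completions X) (orbit h₀ gs (completions X))) ≡ true

opaque
  unfolding triples

  reach-edges : does (reachable? [] edgeMoves triples (orbit e₀ edgeMoves triples)) ≡ true
  reach-edges = refl

  reach-cherries : let C = filter (meetsOnce? e₀) triples in
    does (reachable? (e₀ ∷ []) cherryMoves C (orbit f₀ cherryMoves C)) ≡ true
  reach-cherries = refl

  reach-linear : ReachesCompletions linear (triple 4 5 6) linearMoves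
  reach-linear = refl

  reach-triangles : ReachesCompletions triangle (triple 1 3 5) triangleMoves
  reach-triangles = refl

  reach-sunflowers : ReachesCompletions sunflower (triple 2 5 6) sunflowerMoves
  reach-sunflowers = refl

unact-∈-triples : ∀ w {p} → ∣ p ∣ ≡ 3 → unact w p ∈ₗ triples
unact-∈-triples w {p} size3 = ∈-triples (trans (∣act∣ (reverse w) p) size3)

edge-normal : ∀ {e} → ∣ e ∣ ≡ 3 → ∃ λ w → act w e₀ ≡ e
edge-normal size3 =
  let w , _ , eq = reach [] e₀ edgeMoves triples reach-edges (∈-triples size3) in w , eq

-- Pull `f` back by `w`, so that the first edge becomes `e₀`; reach it from `f₀` by a word fixing
-- `e₀`; then apply `w` again. `config-extend` does the same for a third edge, with words fixing
-- both `e₀` and `f₀`.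
cherry-extend : ∀ w {f} → ∣ f ∣ ≡ 3 → ∣ act w e₀ ∩ f ∣ ≡ 1 →
                ∃ λ v → act v e₀ ≡ act w e₀ × act v f₀ ≡ f
cherry-extend w {f} size3 meet =
  extend (reach (e₀ ∷ []) f₀ cherryMoves C reach-cherries
           (∈-filter⁺ (meetsOnce? e₀) (unact-∈-triples w size3) meet′))
  where
  C : Triples
  C = filter (meetsOnce? e₀) triples
  meet′ : ∣ e₀ ∩ unact w f ∣ ≡ 1
  meet′ = trans (sym (∣act-∩∣ w e₀ (unact w f)))
                (trans (cong (λ g → ∣ act w e₀ ∩ g ∣) (act-unact w f)) meet)
  extend : Reached (e₀ ∷ []) f₀ cherryMoves C (unact w f) →
           ∃ λ v → act v e₀ ≡ act w e₀ × act v f₀ ≡ f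
  extend (v , fix ∷ [] , eq) =
      w ++ v
    , trans (act-++ w v e₀) (cong (act w) fix)
    , trans (act-++ w v f₀) (trans (cong (act w) eq) (act-unact w f))

cherry-normal : ∀ {e f} → ∣ e ∣ ≡ 3 → ∣ f ∣ ≡ 3 → ∣ e ∩ f ∣ ≡ 1 →
                ∃ λ w → act w e₀ ≡ e × act w f₀ ≡ f
cherry-normal {f = f} size3 size3′ meet =
  let w , eq = edge-normal size3 in
  subst (λ e → ∣ e ∩ f ∣ ≡ 1 → ∃ λ w → act w e₀ ≡ e × act w f₀ ≡ f) eq
        (cherry-extend w size3′) meet

module _ (X : Config) (h₀ : Subset 12) (gs : List Word)
         (X⊆cherry : ∀ a b c d → T (X a b c d) → a ≡ 1)
         (reaches : ReachesCompletions X h₀ gs) where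

  config-extend : ∀ w {h} → ∣ h ∣ ≡ 3 → X ∋⟨ act w e₀ , act w f₀ , h ⟩ →
                  ∃ λ v → act v e₀ ≡ act w e₀ × act v f₀ ≡ act w f₀ × act v h₀ ≡ h
  config-extend w {h} size3 x =
    extend (reach (e₀ ∷ f₀ ∷ []) h₀ gs (completions X) reaches
             (∈-filter⁺ (config? X e₀ f₀) (unact-∈-triples w size3) x′))
    where
    x′ : X ∋⟨ e₀ , f₀ , unact w h ⟩
    x′ = subst₂ (λ e f → X ∋⟨ e , f , unact w h ⟩) (unact-act w e₀) (unact-act w f₀)
                (∋-act X (reverse w) (act w e₀) (act w f₀) h x)
    extend : Reached (e₀ ∷ f₀ ∷ []) h₀ gs (completions X) (unact w h) →
             ∃ λ v → act v e₀ ≡ act w e₀ × act v f₀ ≡ act w f₀ × act v h₀ ≡ h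
    extend (v , fix ∷ fix′ ∷ [] , eq) =
        w ++ v
      , trans (act-++ w v e₀) (cong (act w) fix)
      , trans (act-++ w v f₀) (cong (act w) fix′)
      , trans (act-++ w v h₀) (trans (cong (act w) eq) (act-unact w h))

  config-normal : ∀ {e f h} → ∣ e ∣ ≡ 3 → ∣ f ∣ ≡ 3 → ∣ h ∣ ≡ 3 → X ∋⟨ e , f , h ⟩ →
                  ∃ λ w → act w e₀ ≡ e × act w f₀ ≡ f × act w h₀ ≡ h
  config-normal {e} {f} {h} size3 size3′ size3″ x =
    let w , eqe , eqf = cherry-normal size3 size3′ (X⊆cherry (∣ e ∩ f ∣) (∣ f ∩ h ∣) (∣ e ∩ h ∣) (∣ e ∩ f ∩ h ∣) x) in
    subst₂ (λ e f → X ∋⟨ e , f , h ⟩ → ∃ λ w → act w e₀ ≡ e × act w f₀ ≡ f × act w h₀ ≡ h)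
           eqe eqf (config-extend w size3″) x

-- The certificates

-- The triangle has corners 1, 2, 3 and further vertices 0, 4, 5. The splits ask for an edge made of
-- an outside vertex and either a corner with the non-corner vertex of the opposite side, or two
-- corners.
triangleCert : Cert
triangleCert =
  split (triple 0 3 6)
    ((10 ∷ []) ∷ (9 ∷ []) ∷ (4 ∷ 1 ∷ []) ∷ (0 ∷ 1 ∷ 2 ∷ 1 ∷ 0 ∷ 4 ∷ 3 ∷ 2 ∷ 1 ∷ 0 ∷ [])
     ∷ (8 ∷ []) ∷ (7 ∷ []) ∷ (6 ∷ []) ∷ [])
    cover
    (split (triple 1 2 6)
      ((10 ∷ []) ∷ (9 ∷ []) ∷ (4 ∷ 1 ∷ [])
       ∷ (0 ∷ 1 ∷ 2 ∷ 1 ∷ 0 ∷ 4 ∷ 3 ∷ 2 ∷ 1 ∷ 0 ∷ []) ∷ (8 ∷ []) ∷ (7 ∷ []) ∷ (6 ∷ [])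
       ∷ [])
      cover
      -- The two complete 3-graphs on the vertices 0 to 5 and 6 to 11.
      (inside []))

-- The centre is 2, the petals are {0, 1}, {3, 4}, {5, 6}, and 7 to 11 lie outside. The first split
-- asks for an edge through the centre, a petal vertex and an outside vertex.
sunflowerCert : Cert
sunflowerCert =
  split (triple 0 2 7)
    ((10 ∷ []) ∷ (4 ∷ 3 ∷ 5 ∷ 4 ∷ []) ∷ (9 ∷ []) ∷ (1 ∷ 0 ∷ 2 ∷ 1 ∷ 0 ∷ 3 ∷ 2 ∷ 1 ∷ [])
     ∷ (8 ∷ []) ∷ (7 ∷ []) ∷ (0 ∷ []) ∷ [])
    (split (triple 0 1 7)
      []
      (split (triple 3 4 8)
        ((10 ∷ []) ∷ (9 ∷ []) ∷ (4 ∷ 3 ∷ 5 ∷ 4 ∷ []) ∷ (8 ∷ []) ∷ [])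
        cover
        (split (triple 8 9 10)
          ((8 ∷ []) ∷ (9 ∷ []) ∷ (10 ∷ []) ∷ [])
          cover
          -- The comet with centre 2 and head {0, 1, 2, 7}.
          (inside (1 ∷ 6 ∷ 0 ∷ 5 ∷ 4 ∷ 3 ∷ []))))
      (split (triple 3 4 8)
        ((10 ∷ []) ∷ (9 ∷ []) ∷ (4 ∷ 3 ∷ 5 ∷ 4 ∷ []) ∷ (8 ∷ []) ∷ [])
        (split (triple 5 6 9)
          ((10 ∷ []) ∷ (9 ∷ []) ∷ [])
          cover
          (split (triple 5 6 8)
            []
            cover
            (split (triple 9 10 11)
              []
              cover
              (split (triple 2 3 8)
                ((3 ∷ []) ∷ [])
                -- The comet with centre 2 and head {2, 3, 4, 8}.
                (inside (1 ∷ 2 ∷ 3 ∷ 7 ∷ 0 ∷ 1 ∷ 2 ∷ 6 ∷ 5 ∷ 4 ∷ 3 ∷ []))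
                cover))))
        (split (triple 8 9 10)
          ((8 ∷ []) ∷ (9 ∷ []) ∷ (10 ∷ []) ∷ [])
          (split (triple 0 2 11)
            []
            -- The comet with centre 2 and head {2, 8, 9, 10}.
            (inside (1 ∷ 7 ∷ 8 ∷ 9 ∷ 0 ∷ 6 ∷ 7 ∷ 8 ∷ 5 ∷ 6 ∷ 7 ∷ 4 ∷ 5 ∷ 6 ∷ 3 ∷ 4 ∷ 5 ∷ 2
                     ∷ 3 ∷ 4 ∷ 1 ∷ 2 ∷ 3 ∷ []))
            cover)
          -- The star with centre 2.
          (inside (1 ∷ 0 ∷ [])))))
    cover

-- Every leaf is a `cover`: without triangles and sunflowers, a cherry forces at most 31 edges.
cherryCert : Cert
cherryCert =
  split (triple 5 6 7)
    ((8 ∷ []) ∷ (7 ∷ []) ∷ (9 ∷ []) ∷ (6 ∷ []) ∷ (8 ∷ []) ∷ (10 ∷ []) ∷ (7 ∷ [])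
     ∷ (9 ∷ []) ∷ (5 ∷ []) ∷ (8 ∷ []) ∷ (6 ∷ []) ∷ (7 ∷ []) ∷ [])
    (split (triple 0 1 8)
      ((10 ∷ []) ∷ (1 ∷ 0 ∷ 2 ∷ 1 ∷ 0 ∷ 3 ∷ 2 ∷ 1 ∷ []) ∷ (9 ∷ []) ∷ (8 ∷ []) ∷ [])
      cover
      (split (triple 8 9 10)
        ((8 ∷ []) ∷ (9 ∷ []) ∷ (10 ∷ []) ∷ [])
        cover
        cover))
    cover

triangleEdges sunflowerEdges cherryEdges : Triples
triangleEdges  = triple 1 3 5 ∷ f₀ ∷ e₀ ∷ []
sunflowerEdges = triple 2 5 6 ∷ f₀ ∷ e₀ ∷ []
cherryEdges    = f₀ ∷ e₀ ∷ []

Certifies : Config → Triples → Cert → Set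
Certifies X K cert = check X cert K (candidates X K) ≡ true

opaque
  unfolding triples hosts

  triangle-certified : Certifies path triangleEdges triangleCert
  triangle-certified = refl

  sunflower-certified : Certifies (path or triangle) sunflowerEdges sunflowerCert
  sunflower-certified = refl

  cherry-certified : Certifies (path or triangle or sunflower) cherryEdges cherryCert
  cherry-certified = refl

  edge-certified : Certifies cherry (e₀ ∷ []) cover
  edge-certified = refl

-- Bounding the edges of a P-free 3-graph

-- The other two choices of middle edge reduce to `linear` by rotating the three edges cyclically.
avoids-path : ∀ {G} → Avoids linear G → Avoids path G
avoids-path avoids {e} {f} {h} e∈ f∈ h∈ x with Equivalence.to T-∨ x
... | inj₁ y = avoids e∈ f∈ h∈ y
... | inj₂ x′ with Equivalence.to T-∨ x′
...   | inj₁ y = avoids f∈ h∈ e∈ (linear-∩ f h e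
          (let p , q , r = linear⇒ (∣ f ∩ h ∣) (∣ e ∩ h ∣) (∣ e ∩ f ∣) (∣ e ∩ f ∩ h ∣) y
           in p , trans (∣∩∣-comm h e) q , trans (∣∩∣-comm f e) r))
...   | inj₂ y = avoids h∈ e∈ f∈ (linear-∩ h e f
          (let p , q , r = linear⇒ (∣ e ∩ h ∣) (∣ e ∩ f ∣) (∣ f ∩ h ∣) (∣ e ∩ f ∩ h ∣) y
           in trans (∣∩∣-comm h e) p , q , trans (∣∩∣-comm h f) r))

module _ (G : ThreeGraph 12) (free : Free LoosePath₃ G) where

  private
    size3 : ∀ {e} → e ∈ₗ edges G → ∣ e ∣ ≡ 3
    size3 = All.lookup (uniform G)

  free⇒avoids-linear : Avoids linear (edges G)
  free⇒avoids-linear {e} {f} {h} e∈ f∈ h∈ x = embed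
    (config-normal linear (triple 4 5 6) linearMoves (λ a b c d y → proj₁ (linear⇒ a b c d y))
      reach-linear (size3 e∈) (size3 f∈) (size3 h∈) x)
    where
    embed : ¬ ∃ λ w → act w e₀ ≡ e × act w f₀ ≡ f × act w (triple 4 5 6) ≡ h
    embed (w , eqe , eqf , eqh) =
      -- The normal form of `linear` is `LoosePath₃` placed on the first seven of the twelve
      -- vertices.
      free (mk↣ (↑ˡ-injective 5 _ _ ∘ Injection.injective (↔⇒↣ (relabelling w))) , edge)
      where
      image≡ : ∀ p → image ((relabelling w ⟨$⟩ʳ_) ∘ (_↑ˡ 5)) p ≡ act w (image (_↑ˡ 5) p)
      image≡ p = trans (image-∘ (relabelling w ⟨$⟩ʳ_) (_↑ˡ 5) p) (image-relabelling w _)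
      edge : ∀ p → p ∈ₗ edges LoosePath₃ → image ((relabelling w ⟨$⟩ʳ_) ∘ (_↑ˡ 5)) p ∈ₗ edges G
      edge p (here refl)                 = subst (_∈ₗ edges G) (sym (trans (image≡ p) eqe)) e∈
      edge p (there (here refl))         = subst (_∈ₗ edges G) (sym (trans (image≡ p) eqf)) f∈
      edge p (there (there (here refl))) = subst (_∈ₗ edges G) (sym (trans (image≡ p) eqh)) h∈

  private
    certify : ∀ X → Avoids X (edges G) → ∀ K cert → Certifies X K cert →
              ∀ w → All (λ k → act w k ∈ₗ edges G) K → Bounded (edges G)
    certify X avoids K cert ok w known =
      check-sound avoids (unique G) cert w ok (fits-candidates avoids (uniform G) w K known)

    in-G : ∀ {p e} → p ≡ e → e ∈ₗ edges G → p ∈ₗ edges G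
    in-G refl e∈ = e∈

    triangle-bounded : Contains triangle (edges G) → Bounded (edges G)
    triangle-bounded (e , f , h , (e∈ , f∈ , h∈) , x) =
      let w , p , q , r = config-normal triangle (triple 1 3 5) triangleMoves triangle⇒cherry
                            reach-triangles (size3 e∈) (size3 f∈) (size3 h∈) x
      in certify path (avoids-path free⇒avoids-linear) triangleEdges triangleCert triangle-certified w
           (in-G r h∈ ∷ in-G q f∈ ∷ in-G p e∈ ∷ [])

    module _ (no-triangle : Avoids triangle (edges G)) where

      sunflower-bounded : Contains sunflower (edges G) → Bounded (edges G)
      sunflower-bounded (e , f , h , (e∈ , f∈ , h∈) , x) =
        let w , p , q , r = config-normal sunflower (triple 2 5 6) sunflowerMoves sunflower⇒cherry
                              reach-sunflowers (size3 e∈) (size3 f∈) (size3 h∈) x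
        in certify (path or triangle) (avoids-or path triangle (avoids-path free⇒avoids-linear) no-triangle)
             sunflowerEdges sunflowerCert sunflower-certified w
             (in-G r h∈ ∷ in-G q f∈ ∷ in-G p e∈ ∷ [])

      cherry-bounded : Avoids sunflower (edges G) → Contains cherry (edges G) → Bounded (edges G)
      cherry-bounded no-sunflower (e , f , h , (e∈ , f∈ , h∈) , x) =
        let w , p , q = cherry-normal (size3 e∈) (size3 f∈) (cherry⇒ (∣ e ∩ f ∣) (∣ f ∩ h ∣) (∣ e ∩ h ∣) (∣ e ∩ f ∩ h ∣) x)
        in certify (path or triangle or sunflower) (avoids-or path (triangle or sunflower) (avoids-path free⇒avoids-linear)
                     (avoids-or triangle sunflower no-triangle no-sunflower))
             cherryEdges cherryCert cherry-certified w (in-G q f∈ ∷ in-G p e∈ ∷ [])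

    edge-bounded : length (edges G) ≤ 31 ⊎ (∃ λ e → e ∈ₗ edges G) → Avoids cherry (edges G) →
                   Bounded (edges G)
    edge-bounded (inj₁ ≤31)      no-cherry = small ≤31
    edge-bounded (inj₂ (e , e∈)) no-cherry =
      let w , p = edge-normal (size3 e∈)
      in certify cherry no-cherry (e₀ ∷ []) cover edge-certified w (in-G p e∈ ∷ [])

  free⇒bounded : Bounded (edges G)
  free⇒bounded = [ triangle-bounded , without-triangle ]′ (contains⊎avoids triangle (edges G))
    where
    some : ∀ (es : Triples) → length es ≤ 31 ⊎ (∃ λ e → e ∈ₗ es)
    some []      = inj₁ z≤n
    some (e ∷ _) = inj₂ (e , here refl)

    without-triangle : Avoids triangle (edges G) → Bounded (edges G)
    without-triangle no-triangle = [ sunflower-bounded no-triangle , without-sunflower ]′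
      (contains⊎avoids sunflower (edges G))
      where
      without-sunflower : Avoids sunflower (edges G) → Bounded (edges G)
      without-sunflower no-sunflower =
        [ cherry-bounded no-triangle no-sunflower , edge-bounded (some (edges G)) ]′
        (contains⊎avoids cherry (edges G))

-- The hosts

module _ {m n} (f : Fin m ↣ Fin n) where
  open Injection f using (to; injective)

  ∣image-∩∣≡1 : ∀ p q {i} → p ∩ q ≡ ⁅ i ⁆ → ∣ image to p ∩ image to q ∣ ≡ 1
  ∣image-∩∣≡1 p q {i} eq = trans (cong ∣_∣ (trans (image-∩ to injective p q)
    (trans (cong (image to) eq) (image-⁅⁆ to i)))) (∣⁅x⁆∣≡1 (to i))

  image-∩-⊥ : ∀ p q → p ∩ q ≡ ⊥ → image to p ∩ image to q ≡ ⊥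
  image-∩-⊥ p q eq = trans (image-∩ to injective p q) (trans (cong (image to) eq) (image-⊥ to))

-- The condition on two edges stands before the third quantifier, so evaluation tries a third edge
-- only for pairs that satisfy it.
FreeOfLinear FreeOfSunflower : Triples → Set
FreeOfLinear S =
  All (λ e → All (λ h → ∣ e ∩ h ∣ ≡ 0 → All (λ f → ¬ linear ∋⟨ e , f , h ⟩) S) S) S
FreeOfSunflower S =
  All (λ e → All (λ f → ∣ e ∩ f ∣ ≡ 1 → All (λ h → ¬ sunflower ∋⟨ e , f , h ⟩) S) S) S

freeOfLinear? : ∀ S → Dec (FreeOfLinear S)
freeOfLinear? S = All.all? (λ e → All.all? (λ h → (∣ e ∩ h ∣ ≟ 0) →-dec
  All.all? (λ f → ¬? (config? linear e f h)) S) S) S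

freeOfSunflower? : ∀ S → Dec (FreeOfSunflower S)
freeOfSunflower? S = All.all? (λ e → All.all? (λ f → (∣ e ∩ f ∣ ≟ 1) →-dec
  All.all? (λ h → ¬? (config? sunflower e f h)) S) S) S

freeOfLinear⇒free : ∀ S → FreeOfLinear (edges S) → Free LoosePath₃ S
freeOfLinear⇒free S none (f , emb) =
  All.lookup (All.lookup (All.lookup none (emb e (here refl))) (emb h (there (there (here refl))))
                disjoint)
    (emb g (there (here refl)))
    (linear-∩ (image to e) (image to g) (image to h)
      (∣image-∩∣≡1 f e g {# 2} refl , ∣image-∩∣≡1 f g h {# 4} refl , disjoint))
  where
  open Injection f using (to)
  e g h : Subset 7
  e = triple 0 1 2
  g = triple 2 3 4
  h = triple 4 5 6
  disjoint : ∣ image to e ∩ image to h ∣ ≡ 0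
  disjoint = trans (cong ∣_∣ (image-∩-⊥ f e h refl)) (∣⊥∣≡0 12)

-- An embedding keeps `e` and `h` disjoint, yet both images would contain the centre.
disjoint-⋢-star : ∀ {m n} {S : ThreeGraph m} {c : Fin n} {e h} → e ∈ₗ edges S → h ∈ₗ edges S →
                  e ∩ h ≡ ⊥ → ¬ (S ⊑ FullStar c)
disjoint-⋢-star {n = n} {c = c} {e} {h} e∈ h∈ eq (f , emb) =
  ∉⊥ (subst (c ∈_) (image-∩-⊥ f e h eq) (x∈p∩q⁺ (centre e∈ , centre h∈)))
  where
  centre : ∀ {p} → p ∈ₗ _ → c ∈ image (Injection.to f) p
  centre p∈ = proj₂ (∈-filter⁻ (c ∈?_) {xs = subsetsOfSize n 3} (emb _ p∈))

star-free : Free LoosePath₃ star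
star-free = freeOfLinear⇒free star (does⇒ (freeOfLinear? (edges star)) refl)

K₆K₆-free : Free LoosePath₃ K₆K₆
K₆K₆-free = freeOfLinear⇒free K₆K₆ (does⇒ (freeOfLinear? (edges K₆K₆)) refl)

comet-free : Free LoosePath₃ comet
comet-free = freeOfLinear⇒free comet (does⇒ (freeOfLinear? (edges comet)) refl)

K₆K₆⋢star : ¬ (K₆K₆ ⊑ FullStar {12} zero)
K₆K₆⋢star = disjoint-⋢-star {S = K₆K₆} {c = zero} {e = triple 0 1 2} {triple 6 7 8}
  (does⇒ (_ ∈ₗ? edges K₆K₆) refl) (does⇒ (_ ∈ₗ? edges K₆K₆) refl) refl

comet⋢star : ¬ (comet ⊑ FullStar {12} zero)
comet⋢star = disjoint-⋢-star {S = comet} {c = zero} {e = triple 1 2 3} {triple 0 4 5}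
  (does⇒ (_ ∈ₗ? edges comet) refl) (does⇒ (_ ∈ₗ? edges comet) refl) refl

-- The copies of K₆ have too few vertices for three edges pairwise meeting in one common vertex.
comet⋢K₆K₆ : ¬ (comet ⊑ K₆K₆)
comet⋢K₆K₆ (f , emb) =
  All.lookup (All.lookup (All.lookup none (emb e (mem e refl))) (emb g (mem g refl))
               (∣image-∩∣≡1 f e g {zero} refl))
    (emb h (mem h refl)) sun
  where
  none : FreeOfSunflower (edges K₆K₆)
  none = does⇒ (freeOfSunflower? (edges K₆K₆)) refl
  mem : ∀ p → does (p ∈ₗ? edges comet) ≡ true → p ∈ₗ edges comet
  mem p = does⇒ (p ∈ₗ? edges comet)
  e g h : Subset 12
  e = triple 0 4 5
  g = triple 0 6 7
  h = triple 0 8 9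
  open Injection f using (to; injective)
  sun : sunflower ∋⟨ image to e , image to g , image to h ⟩
  sun = sunflower-∩ (image to e) (image to g) (image to h) (∣image-∩∣≡1 f e g {zero} refl) (∣image-∩∣≡1 f g h {zero} refl)
                    (∣image-∩∣≡1 f e h {zero} refl)
                    (trans (cong (λ p → ∣ image to e ∩ p ∣) (image-∩ to injective g h))
                           (∣image-∩∣≡1 f e (g ∩ h) {zero} refl))

-- The Turán numbers

↪⇒⊑ : ∀ {G S} → edges G ↪ S → G ⊑ S
↪⇒⊑ (π , emb) = ↔⇒↣ π , λ e e∈ → emb e∈

opaque
  unfolding hosts

  classify : ∀ G → Free LoosePath₃ G →
             size G ≤ 31 ⊎ G ⊑ star ⊎ G ⊑ K₆K₆ ⊎ edges G ↪ comet
  classify G free with free⇒bounded G free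
  ... | small ≤31                           = inj₁ ≤31
  ... | embedded (here emb)                 = inj₂ (inj₁ (↪⇒⊑ {G} {star} emb))
  ... | embedded (there (here emb))         = inj₂ (inj₂ (inj₁ (↪⇒⊑ {G} {K₆K₆} emb)))
  ... | embedded (there (there (here emb))) = inj₂ (inj₂ (inj₂ emb))

↪-size : ∀ {G S} → edges G ↪ S → size G ≤ size S
↪-size {G} {S} emb = ⊑⇒size≤ {G = G} {H = S} (↪⇒⊑ {G} {S} emb)

-- The images of the edges of `G` form a duplicate-free list inside `edges S` and at least as long,
-- so they exhaust it.
↪-full⇒≅ : ∀ {G S} → edges G ↪ S → size S ≤ size G → G ≅ S
↪-full⇒≅ {G} {S} (π , emb) S≤G = π , λ e → mk⇔ emb (from e)
  where
  to = π ⟨$⟩ʳ_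
  inj : Injective _≡_ _≡_ (image to)
  inj = image-injective to (Injection.injective (↔⇒↣ π))
  sub : ∀ {p} → p ∈ₗ map (image to) (edges G) → p ∈ₗ edges S
  sub p∈ with ∈-map⁻ (image to) p∈
  ... | _ , e∈ , refl = emb e∈
  from : ∀ e → image to e ∈ₗ edges S → e ∈ₗ edges G
  from e e∈ with ∈-map⁻ (image to) (unique-⊆-full _≟ˢ_ (Uniqueₚ.map⁺ inj (unique G)) sub
                   (≤-trans S≤G (≤-reflexive (sym (length-map (image to) (edges G))))) e∈)
  ... | _ , e′∈ , eq = subst (_∈ₗ edges G) (sym (inj eq)) e′∈

≅⇒⊑ : ∀ {m n} {G : ThreeGraph m} {H : ThreeGraph n} → G ≅ H → G ⊑ H
≅⇒⊑ (π , iff) = ↔⇒↣ π , λ e → Equivalence.to (iff e)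

≅⇒⊒ : ∀ {m n} {G : ThreeGraph m} {H : ThreeGraph n} → G ≅ H → H ⊑ G
≅⇒⊒ {H = H} (π , iff) = ↔⇒↣ (Perm.flip π) , λ e e∈ →
  Equivalence.from (iff _)
    (subst (_∈ₗ edges H) (sym (image-inverse {f = π ⟨$⟩ˡ_} {π ⟨$⟩ʳ_} (λ _ → Perm.inverseʳ π) e)) e∈)

third-bound : ∀ G → Free LoosePath₃ G → ¬ (G ⊑ star) → ¬ (G ⊑ K₆K₆) →
              (size G ≤ 32) × (size G ≡ 32 → G ≅ comet)
third-bound G free ⋢star ⋢K₆K₆ with classify G free
... | inj₁ ≤31                  =
  ≤-trans ≤31 (n≤1+n 31) , λ eq → contradiction (subst (_≤ 31) eq ≤31) 1+n≰n
... | inj₂ (inj₁ ⊑star)         = contradiction ⊑star ⋢star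
... | inj₂ (inj₂ (inj₁ ⊑K₆K₆))  = contradiction ⊑K₆K₆ ⋢K₆K₆
... | inj₂ (inj₂ (inj₂ emb))    =
  ↪-size {G} {comet} emb , λ eq → ↪-full⇒≅ {G} {comet} emb (≤-reflexive (sym eq))

size≤55 : ∀ G → Free LoosePath₃ G → size G ≤ 55
size≤55 G free with classify G free
... | inj₁ ≤31                 = ≤-trans ≤31 (m≤m+n 31 24)
... | inj₂ (inj₁ ⊑star)        = ⊑⇒size≤ {G = G} {star} ⊑star
... | inj₂ (inj₂ (inj₁ ⊑K₆K₆)) = ≤-trans (⊑⇒size≤ {G = G} {K₆K₆} ⊑K₆K₆) (m≤m+n 40 15)
... | inj₂ (inj₂ (inj₂ emb))   = ≤-trans (↪-size {G} {comet} emb) (m≤m+n 32 23)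

size≤40 : ∀ G → Free LoosePath₃ G → ¬ (G ⊑ star) → size G ≤ 40
size≤40 G free ⋢star with classify G free
... | inj₁ ≤31                 = ≤-trans ≤31 (m≤m+n 31 9)
... | inj₂ (inj₁ ⊑star)        = contradiction ⊑star ⋢star
... | inj₂ (inj₂ (inj₁ ⊑K₆K₆)) = ⊑⇒size≤ {G = G} {K₆K₆} ⊑K₆K₆
... | inj₂ (inj₂ (inj₂ emb))   = ≤-trans (↪-size {G} {comet} emb) (m≤m+n 32 8)

star-maximal : Maximal (Candidate LoosePath₃ 0) star
star-maximal = star-free , size≤55

⊑star-or-small : ∀ G → Free LoosePath₃ G → 41 ≤ size G → G ⊑ star
⊑star-or-small G free large with classify G free
... | inj₁ ≤31                 = contradiction (≤-trans large (≤-trans ≤31 (m≤m+n 31 9))) 1+n≰n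
... | inj₂ (inj₁ ⊑star)        = ⊑star
... | inj₂ (inj₂ (inj₁ ⊑K₆K₆)) = contradiction (≤-trans large (⊑⇒size≤ {G = G} {K₆K₆} ⊑K₆K₆)) 1+n≰n
... | inj₂ (inj₂ (inj₂ emb))   =
  contradiction (≤-trans large (≤-trans (↪-size {G} {comet} emb) (m≤m+n 32 8))) 1+n≰n

-- An extremal `H` has at least the 55 edges of the star, more than K₆ ∪ K₆ or the comet can hold.
-- By transitivity, avoiding all extremal 3-graphs then reduces to avoiding the star.
maximal₁⇒⊑star : ∀ H → Maximal (Candidate LoosePath₃ 0) H → H ⊑ star
maximal₁⇒⊑star H (free , maximal) =
  ⊑star-or-small H free (≤-trans (m≤m+n 41 14) (maximal star star-free))

candidate₁⇒⋢star : ∀ {G} → Candidate LoosePath₃ 1 G → ¬ (G ⊑ star)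
candidate₁⇒⋢star (_ , ⋢) = ⋢ star star-maximal

⋢star⇒candidate₁ : ∀ {G} → Free LoosePath₃ G → ¬ (G ⊑ star) → Candidate LoosePath₃ 1 G
⋢star⇒candidate₁ {G} free ⋢star = free , λ H maximal G⊑H →
  ⋢star (⊑-trans {F = G} {H} {star} G⊑H (maximal₁⇒⊑star H maximal))

K₆K₆-maximal : Maximal (Candidate LoosePath₃ 1) K₆K₆
K₆K₆-maximal = ⋢star⇒candidate₁ {K₆K₆} K₆K₆-free K₆K₆⋢star ,
  λ H candidate → size≤40 H (proj₁ candidate) (candidate₁⇒⋢star {H} candidate)

-- Such an `H` has at least 40 edges, which excludes the comet and the bound 31, and being a
-- candidate excludes the star.
maximal₂⇒⊑K₆K₆ : ∀ H → Maximal (Candidate LoosePath₃ 1) H → H ⊑ K₆K₆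
maximal₂⇒⊑K₆K₆ H (candidate , maximal) with classify H (proj₁ candidate)
... | inj₁ ≤31                 =
  contradiction (≤-trans (maximal K₆K₆ (proj₁ K₆K₆-maximal)) (≤-trans ≤31 (m≤m+n 31 8))) 1+n≰n
... | inj₂ (inj₁ ⊑star)        = contradiction ⊑star (candidate₁⇒⋢star {H} candidate)
... | inj₂ (inj₂ (inj₁ ⊑K₆K₆)) = ⊑K₆K₆
... | inj₂ (inj₂ (inj₂ emb))   =
  contradiction (≤-trans (maximal K₆K₆ (proj₁ K₆K₆-maximal))
                  (≤-trans (↪-size {H} {comet} emb) (m≤m+n 32 7))) 1+n≰n

⋢⇒candidate₂ : ∀ {G} → Free LoosePath₃ G → ¬ (G ⊑ star) → ¬ (G ⊑ K₆K₆) → Candidate LoosePath₃ 2 G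
⋢⇒candidate₂ {G} free ⋢star ⋢K₆K₆ = ⋢star⇒candidate₁ {G} free ⋢star , λ H maximal G⊑H →
  ⋢K₆K₆ (⊑-trans {F = G} {H} {K₆K₆} G⊑H (maximal₂⇒⊑K₆K₆ H maximal))

candidate₂-bound : ∀ G → Candidate LoosePath₃ 2 G → (size G ≤ 32) × (size G ≡ 32 → G ≅ comet)
candidate₂-bound G (candidate₁ , ⋢) =
  third-bound G (proj₁ candidate₁) (candidate₁⇒⋢star {G} candidate₁) (⋢ K₆K₆ K₆K₆-maximal)

comet-candidate₂ : Candidate LoosePath₃ 2 comet
comet-candidate₂ = ⋢⇒candidate₂ {comet} comet-free comet⋢star comet⋢K₆K₆

extremal⇒≅comet : ∀ G → Ex 3 LoosePath₃ G → G ≅ comet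
extremal⇒≅comet G (candidate , maximal) =
  let ≤32 , full = candidate₂-bound G candidate in full (≤-antisym ≤32 (maximal comet comet-candidate₂))

≅comet⇒extremal : ∀ G → G ≅ comet → Ex 3 LoosePath₃ G
≅comet⇒extremal G G≅comet =
    ⋢⇒candidate₂ {G}
      (λ path⊑G → comet-free (⊑-trans {F = LoosePath₃} {G} {comet} path⊑G G⊑comet))
      (λ G⊑star → comet⋢star (⊑-trans {F = comet} {G} {star} comet⊑G G⊑star))
      (λ G⊑K₆K₆ → comet⋢K₆K₆ (⊑-trans {F = comet} {G} {K₆K₆} comet⊑G G⊑K₆K₆))
  , λ H candidate → ≤-trans (proj₁ (candidate₂-bound H candidate)) (⊑⇒size≤ {G = comet} {G} comet⊑G)
  where
  G⊑comet : G ⊑ comet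
  G⊑comet = ≅⇒⊑ {G = G} {comet} G≅comet
  comet⊑G : comet ⊑ G
  comet⊑G = ≅⇒⊒ {G = G} {comet} G≅comet

mainTheorem3 : (ex[ 3 ]⟨ 12 , LoosePath₃ ⟩≡ 32) ×
    (∀ (G : ThreeGraph 12) → Ex 3 LoosePath₃ G ⇔ G ≅ Comet 8) ×
    (∀ (G : ThreeGraph 12) → Free LoosePath₃ G →
    ¬ (G ⊑ FullStar {12} zero) → ¬ (G ⊑ (Complete 6 ⊍ Complete 6)) →
    (size G ≤ 32) × (size G ≡ 32 → G ≅ Comet 8))
mainTheorem3 =
    ( (comet , comet-candidate₂ , refl)
    , λ G candidate → proj₁ (candidate₂-bound G candidate))
  , (λ G → mk⇔ (extremal⇒≅comet G) (≅comet⇒extremal G))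
  , third-bound
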